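{- For any integer $n \geq 0$ (with $a$ denoting a nonnegative integer), $$v_2(B_n(4,1)) = \begin{cases} 1+v_2(a), & \text{if } n=5a \text{ and } v_2(a) \leq 5, \\ 0, & \text{if } n \equiv 1 \pmod{5}, \\ 1+ v_2(a), & \text{if } n=5a + 2 \text{ and } v_2(a) \leq 4, \\ 1+ v_2 \big( a(a+1) \big), & \text{if } n=5a + 3 \text{ and } v_2 \big( a(a+1) \big) \leq 5, \\ 0, & \text{if } n \equiv 4 \pmod{5}. \end{cases}$$ (No assertion is made for values of $n$ not covered by these cases.)
   Context: The sequence $\{B_n(4,1)\}_{n\geq 0}$ is defined by $B_n = B_{n-1}+B_{n-2}+B_{n-3}+B_{n-4}$ for $n \geq 4$, with $(B_0,B_1,B_2,B_3)=(0,1,0,0)$. $v_2$ denotes the 2-adic order (2-adic valuation), with the convention $v_2(0)=+\infty$. -}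

module Defs where

open import Data.Nat using (ℕ; zero; suc; _+_; _^_; _≤_; _<_; z≤n; s≤s; s≤s⁻¹)
open import Data.Nat.Divisibility
  using (_∣_; _∣?_; _∣0; ∣-trans; ∣⇒≤; 1∣_; m∣m*n)
open import Data.Nat.Properties
  using (≤-trans; <⇒≤; m≤n⇒m<n∨m≡n; m≤n⇒∃[o]m+o≡n;
         ^-distribˡ-+-*; +-mono-≤; +-identityʳ; m^n>0)
open import Data.Product using (_,_)
open import Data.Sum using (inj₁; inj₂)
open import Function.Bundles using (_⇔_; mk⇔)
open import Relation.Binary.PropositionalEquality using (refl; sym; subst)
open import Relation.Nullary using (yes; no; contradiction)
open import Relation.Nullary.Construct.Add.Supremum using (_⁺; ⊤⁺; [_])
open import Relation.Binary.Construct.Add.Supremum.NonStrict _≤_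
  using (_≤⁺_; _≤⊤⁺; [_]; [≤]-injective)

B[4,1] : ℕ → ℕ
B[4,1] 0 = 0
B[4,1] 1 = 1
B[4,1] 2 = 0
B[4,1] 3 = 0
B[4,1] (suc (suc (suc (suc n)))) =
  B[4,1] (suc (suc (suc n))) + B[4,1] (suc (suc n)) + B[4,1] (suc n) + B[4,1] n

ℕ∞ : Set
ℕ∞ = ℕ ⁺

infixl 6 _+∞_

_+∞_ : ℕ∞ → ℕ∞ → ℕ∞
[ m ] +∞ [ n ] = [ m + n ]
[ m ] +∞ ⊤⁺    = ⊤⁺
⊤⁺    +∞ _     = ⊤⁺

-- The largest k ≤ bound with 2 ^ k ∣ n.
maxExponent : (n bound : ℕ) → ℕ
maxExponent n zero = zero
maxExponent n (suc k) with 2 ^ suc k ∣? n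
... | yes _ = suc k
... | no  _ = maxExponent n k

-- For n > 0 the bound n is never restrictive, since 2 ^ k ∣ n forces k < n.
v₂ : ℕ → ℕ∞
v₂ zero      = ⊤⁺
v₂ n@(suc _) = [ maxExponent n n ]

private

  n<2^n : ∀ n → n < 2 ^ n
  n<2^n zero    = s≤s z≤n
  n<2^n (suc n) = +-mono-≤ (m^n>0 2 n)
    (subst (suc n ≤_) (sym (+-identityʳ (2 ^ n))) (n<2^n n))

  ^-monoʳ-∣ : ∀ {j k} → j ≤ k → 2 ^ j ∣ 2 ^ k
  ^-monoʳ-∣ {j} j≤k with m≤n⇒∃[o]m+o≡n j≤k
  ... | o , refl = subst (2 ^ j ∣_) (sym (^-distribˡ-+-* 2 j o)) (m∣m*n (2 ^ o))

  2^maxExponent∣ : ∀ n b → 2 ^ maxExponent n b ∣ n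
  2^maxExponent∣ n zero = 1∣ n
  2^maxExponent∣ n (suc b) with 2 ^ suc b ∣? n
  ... | yes d = d
  ... | no  _ = 2^maxExponent∣ n b

  maxExponent-max : ∀ n b {k} → k ≤ b → 2 ^ k ∣ n → k ≤ maxExponent n b
  maxExponent-max n zero    k≤b d = k≤b
  maxExponent-max n (suc b) k≤b d with 2 ^ suc b ∣? n
  ... | yes _ = k≤b
  ... | no ¬d with m≤n⇒m<n∨m≡n k≤b
  ...   | inj₁ k<1+b = maxExponent-max n b (s≤s⁻¹ k<1+b) d
  ...   | inj₂ refl  = contradiction d ¬d

2^k∣n⇔k≤v₂n : ∀ k n → 2 ^ k ∣ n ⇔ [ k ] ≤⁺ v₂ n
2^k∣n⇔k≤v₂n k zero      = mk⇔ (λ _ → [ k ] ≤⊤⁺) (λ _ → (2 ^ k) ∣0)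
2^k∣n⇔k≤v₂n k n@(suc _) = mk⇔
  (λ d → [ maxExponent-max n n (≤-trans (<⇒≤ (n<2^n k)) (∣⇒≤ d)) d ])
  (λ k≤v → ∣-trans (^-monoʳ-∣ ([≤]-injective k≤v)) (2^maxExponent∣ n n))

{-# OPTIONS --safe #-}

-- The sequence modulo 2 ^ 7 has period 5 * 2 ^ 6. A valuation of at most k is
-- determined by the residue modulo 2 ^ (k + 1), and all valuations asserted
-- below are at most 6, so it suffices to inspect a = 0, …, 63 in every residue
-- class of n modulo 5.
module Submission where

open import Defs using (B[4,1]; v₂; _+∞_; 2^k∣n⇔k≤v₂n)
open import Data.Nat using (ℕ; zero; suc; _+_; _*_; _^_; _≤_; _<_; z≤n; s≤s; NonZero)
open import Data.Nat.Divisibility using (_∣_; m∣m*n; ∣n∣m%n⇒∣m; %-presˡ-∣)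
open import Data.Nat.DivMod
  using (_%_; _/_; m≡m%n+[m/n]*n; m%n<n; m%n%n≡m%n; %-distribˡ-+; %-distribˡ-*)
open import Data.Nat.GeneralisedArithmetic using (fold; fold-+)
open import Data.Nat.Properties
  using (_≟_; _≤?_; allUpTo?; ≤-trans; ≤-antisym; ≤-refl; n≮n; ≮⇒≥; m≤n⇒m≤1+n;
         +-monoʳ-≤; +-identityʳ; +-comm; *-comm; m^n≢0; ^-distribˡ-+-*; m≤n⇒∃[o]m+o≡n)
open import Data.Nat.Tactic.RingSolver using (solve-∀)
open import Data.Product using (_×_; _,_; proj₁)
open import Function using (id; const)
open import Function.Bundles using (module Equivalence)
open import Relation.Binary.PropositionalEquality
  using (_≡_; refl; sym; trans; cong; cong₂; subst; module ≡-Reasoning)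
open import Relation.Nullary using (Dec; ¬_; contradiction)
open import Relation.Nullary.Decidable using (True; toWitness; _→-dec_)
open import Relation.Nullary.Construct.Add.Supremum using ([_]; ≡-dec)
open import Relation.Binary.Construct.Add.Supremum.NonStrict _≤_
  using (_≤⁺_; _≤⊤⁺; [_]; [≤]-injective; ≤⁺-dec; ≤⁺-trans)

open Equivalence using (to; from)

2^j∣2^k : ∀ {j k} → j ≤ k → 2 ^ j ∣ 2 ^ k
2^j∣2^k {j} j≤k with o , refl ← m≤n⇒∃[o]m+o≡n j≤k =
  subst (2 ^ j ∣_) (sym (^-distribˡ-+-* 2 j o)) (m∣m*n (2 ^ o))

∣-resp-% : ∀ {d N m n} .{{_ : NonZero N}} → d ∣ N → m % N ≡ n % N → d ∣ m → d ∣ n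
∣-resp-% d∣N eq d∣m = ∣n∣m%n⇒∣m d∣N (subst (_ ∣_) eq (%-presˡ-∣ d∣m d∣N))

≤⁺-squeeze : ∀ {j v} → [ j ] ≤⁺ v → ¬ [ suc j ] ≤⁺ v → v ≡ [ j ]
≤⁺-squeeze [ j≤l ]    j≮l = cong [_] (≤-antisym (≮⇒≥ λ j<l → j≮l [ j<l ]) j≤l)
≤⁺-squeeze (_ ≤⊤⁺)    j≮⊤ = contradiction (_ ≤⊤⁺) j≮⊤

-- For `j ≤ k`, divisibility by `2 ^ j` and by `2 ^ suc j` depends only on the residue modulo
-- `2 ^ suc k`, and these two tests pin the valuation to `j`. A bound on one side suffices: it makes
-- `v₂ m` finite, and the tests carry it over to `n`.
v₂-cong-% : ∀ k {m n} (let instance _ = m^n≢0 2 (suc k)) →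
            m % 2 ^ suc k ≡ n % 2 ^ suc k → v₂ m ≤⁺ [ k ] → v₂ n ≡ v₂ m
v₂-cong-% k {m} {n} eq v≤k with v₂ m in v≡ | v≤k
... | [ j ] | [ j≤k ] = ≤⁺-squeeze
  (to (2^k∣n⇔k≤v₂n j n) (∣-resp-% (2^j∣2^k (m≤n⇒m≤1+n j≤k)) eq
    (from (2^k∣n⇔k≤v₂n j m) (subst ([ j ] ≤⁺_) (sym v≡) [ ≤-refl ]))))
  λ j<v → n≮n j ([≤]-injective (subst ([ suc j ] ≤⁺_) v≡
    (to (2^k∣n⇔k≤v₂n (suc j) m) (∣-resp-% (2^j∣2^k (s≤s j≤k)) (sym eq)
      (from (2^k∣n⇔k≤v₂n (suc j) n) j<v)))))
  where instance _ = m^n≢0 2 (suc k)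

-- Four consecutive terms are the full state of the recurrence, so a single return to the initial
-- window proves periodicity; a repeated single term would not.
Window : Set
Window = ℕ × ℕ × ℕ × ℕ

initial : Window
initial = 0 , 1 , 0 , 0

step : Window → Window
step (w , x , y , z) = x , y , z , (z + y + x + w) % 2 ^ 7

-- Iterating on windows keeps the evaluation of residues linear in n; the
-- defining recursion of B[4,1] takes exponential time.
window : ℕ → Window
window = fold initial step

residue : ℕ → ℕ
residue n = proj₁ (window n)

+-resp-% : ∀ m m′ n n′ d .{{_ : NonZero d}} → m % d ≡ m′ % d → n % d ≡ n′ % d →
           (m + n) % d ≡ (m′ + n′) % d
+-resp-% m m′ n n′ d p q = begin
  (m + n) % d            ≡⟨ %-distribˡ-+ m n d ⟩
  (m % d + n % d) % d    ≡⟨ cong₂ (λ x y → (x + y) % d) p q ⟩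
  (m′ % d + n′ % d) % d  ≡⟨ %-distribˡ-+ m′ n′ d ⟨
  (m′ + n′) % d          ∎
  where open ≡-Reasoning

*-resp-% : ∀ m m′ n n′ d .{{_ : NonZero d}} → m % d ≡ m′ % d → n % d ≡ n′ % d →
           (m * n) % d ≡ (m′ * n′) % d
*-resp-% m m′ n n′ d p q = begin
  (m * n) % d              ≡⟨ %-distribˡ-* m n d ⟩
  (m % d * (n % d)) % d    ≡⟨ cong₂ (λ x y → (x * y) % d) p q ⟩
  (m′ % d * (n′ % d)) % d  ≡⟨ %-distribˡ-* m′ n′ d ⟨
  (m′ * n′) % d            ∎
  where open ≡-Reasoning

%-absorb-sum₄ : ∀ w x y z d .{{_ : NonZero d}} →
                (z % d + y % d + x % d + w % d) % d ≡ (z + y + x + w) % d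
%-absorb-sum₄ w x y z d =
  +-resp-% (z % d + y % d + x % d) (z + y + x) (w % d) w d
    (+-resp-% (z % d + y % d) (z + y) (x % d) x d
      (+-resp-% (z % d) z (y % d) y d (m%n%n≡m%n z d) (m%n%n≡m%n y d))
      (m%n%n≡m%n x d))
    (m%n%n≡m%n w d)

window≡B%2^7 : ∀ n → window n ≡
  (B[4,1] n % 2 ^ 7 , B[4,1] (1 + n) % 2 ^ 7 , B[4,1] (2 + n) % 2 ^ 7 , B[4,1] (3 + n) % 2 ^ 7)
window≡B%2^7 zero    = refl
window≡B%2^7 (suc n) = trans (cong step (window≡B%2^7 n))
  (cong (λ t → B[4,1] (1 + n) % 2 ^ 7 , B[4,1] (2 + n) % 2 ^ 7 , B[4,1] (3 + n) % 2 ^ 7 , t)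
    (%-absorb-sum₄ (B[4,1] n) (B[4,1] (1 + n)) (B[4,1] (2 + n)) (B[4,1] (3 + n)) (2 ^ 7)))

-- The `q` full periods are run first and lead back to `z`; the remaining `n` steps then start from
-- `z` itself.
fold-periodic : ∀ {A : Set} (z : A) s p → fold z s p ≡ z →
                ∀ q n → fold z s (n + q * p) ≡ fold z s n
fold-periodic z s p eq q n =
  trans (fold-+ z s n) (cong (λ z′ → fold z′ s n) (multiple q))
  where
  multiple : ∀ q → fold z s (q * p) ≡ z
  multiple zero    = refl
  multiple (suc q) = trans (fold-+ z s p) (trans (cong (λ z′ → fold z′ s p) (multiple q)) eq)

window-320 : window 320 ≡ initial
window-320 = refl

-- Adding 64 to `a` moves the index by 5 * 64 = 320, one full period, so only `a % 2 ^ 6` matters.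
B%2^7≡residue : ∀ a c → B[4,1] (5 * a + c) % 2 ^ 7 ≡ residue (5 * (a % 2 ^ 6) + c)
B%2^7≡residue a c = begin
  B[4,1] (5 * a + c) % 2 ^ 7   ≡⟨ cong proj₁ (window≡B%2^7 (5 * a + c)) ⟨
  residue (5 * a + c)          ≡⟨ cong (λ # → residue (5 * # + c)) (m≡m%n+[m/n]*n a (2 ^ 6)) ⟩
  residue (5 * (r + q * 64) + c)    ≡⟨ cong residue (regroup r q c) ⟩
  residue ((5 * r + c) + q * 320)   ≡⟨ cong proj₁ (fold-periodic initial step 320 window-320 q (5 * r + c)) ⟩
  residue (5 * r + c)          ∎
  where
  open ≡-Reasoning
  r q : ℕ
  r = a % 2 ^ 6
  q = a / 2 ^ 6
  regroup : ∀ r q c → 5 * (r + q * 64) + c ≡ (5 * r + c) + q * 320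
  regroup = solve-∀

-- g r is reduced because v₂ n tries all exponents from n downwards, which is
-- too slow for n = r * (r + 1).
ValuationAt : (s k c : ℕ) (g : ℕ → ℕ) → ℕ → Set
ValuationAt s k c g r =
  v₂ (g r % 2 ^ 6) ≤⁺ [ k ] → v₂ (residue (5 * r + c)) ≡ [ s ] +∞ v₂ (g r % 2 ^ 6)

valuations? : ∀ s k c g → Dec (∀ {r} → r < 2 ^ 6 → ValuationAt s k c g r)
valuations? s k c g = allUpTo? (λ r →
  -- If `g r` reduces to 0, its valuation is `⊤⁺` and the implication is vacuous: such an `r` does
  -- not determine the valuation of `g a`.
  ≤⁺-dec _≤?_ (v₂ (g r % 2 ^ 6)) [ k ] →-dec
  ≡-dec _≟_ (v₂ (residue (5 * r + c))) ([ s ] +∞ v₂ (g r % 2 ^ 6))) (2 ^ 6)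

+∞-monoʳ-≤⁺ : ∀ s {v k} → v ≤⁺ [ k ] → [ s ] +∞ v ≤⁺ [ s + k ]
+∞-monoʳ-≤⁺ s [ v≤k ] = [ +-monoʳ-≤ s v≤k ]

-- Extends the finite check to all `a` by two transfers: `v₂ (g a)`, at most 5, survives reduction
-- modulo `2 ^ 6`, and the resulting valuation, at most `s + k ≤ 6`, survives reduction modulo
-- `2 ^ 7`.
v₂-B : ∀ s k c g → (∀ a → g (a % 2 ^ 6) % 2 ^ 6 ≡ g a % 2 ^ 6) →
       {_ : True (k ≤? 5)} {_ : True (s + k ≤? 6)} →
       (∀ {r} → r < 2 ^ 6 → ValuationAt s k c g r) →
       ∀ a → v₂ (g a) ≤⁺ [ k ] → v₂ (B[4,1] (5 * a + c)) ≡ [ s ] +∞ v₂ (g a)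
v₂-B s k c g g-% {k≤5} {s+k≤6} valuations a v≤k = begin
  v₂ (B[4,1] (5 * a + c))       ≡⟨ v₂-cong-% 6 residue%≡ residue≤6 ⟩
  v₂ (residue (5 * r + c))      ≡⟨ v₂-residue ⟩
  [ s ] +∞ v₂ (g a)             ∎
  where
  open ≡-Reasoning
  r : ℕ
  r = a % 2 ^ 6
  v₂-g : v₂ (g r % 2 ^ 6) ≡ v₂ (g a)
  v₂-g = v₂-cong-% 5 (sym (trans (m%n%n≡m%n (g r) (2 ^ 6)) (g-% a)))
                     (≤⁺-trans ≤-trans v≤k [ toWitness k≤5 ])
  v₂-residue : v₂ (residue (5 * r + c)) ≡ [ s ] +∞ v₂ (g a)
  v₂-residue = trans
    (valuations (m%n<n a (2 ^ 6)) (subst (_≤⁺ [ k ]) (sym v₂-g) v≤k))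
    (cong ([ s ] +∞_) v₂-g)
  -- The bound is known only on the residue side at this point, so the transfer runs from the
  -- residue to `B[4,1]`.
  residue≤6 : v₂ (residue (5 * r + c)) ≤⁺ [ 6 ]
  residue≤6 = subst (_≤⁺ [ 6 ]) (sym v₂-residue)
    (≤⁺-trans ≤-trans (+∞-monoʳ-≤⁺ s v≤k) [ toWitness s+k≤6 ])
  residue%≡ : residue (5 * r + c) % 2 ^ 7 ≡ B[4,1] (5 * a + c) % 2 ^ 7
  residue%≡ = trans (cong (_% 2 ^ 7) (sym (B%2^7≡residue a c))) (m%n%n≡m%n (B[4,1] (5 * a + c)) (2 ^ 7))

n≡5*[n/5]+c : ∀ n {c} → n % 5 ≡ c → n ≡ 5 * (n / 5) + c
n≡5*[n/5]+c n refl = begin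
  n                    ≡⟨ m≡m%n+[m/n]*n n 5 ⟩
  n % 5 + n / 5 * 5    ≡⟨ +-comm (n % 5) _ ⟩
  n / 5 * 5 + n % 5    ≡⟨ cong (_+ n % 5) (*-comm (n / 5) 5) ⟩
  5 * (n / 5) + n % 5  ∎
  where open ≡-Reasoning

-- Taking `g` constantly 1 makes `v₂ (g a)` zero, so the general transfer applies with its
-- hypothesis always satisfied and yields valuation 0.
v₂-B-odd : ∀ c → (∀ {r} → r < 2 ^ 6 → ValuationAt 0 0 c (const 1) r) →
           ∀ n → n % 5 ≡ c → v₂ (B[4,1] n) ≡ [ 0 ]
v₂-B-odd c valuations n eq = trans (cong (λ # → v₂ (B[4,1] #)) (n≡5*[n/5]+c n eq))
  (v₂-B 0 0 c (const 1) (λ _ → refl) valuations (n / 5) [ z≤n ])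

theorem14 : ∀ (n : ℕ) →
    (∀ (a : ℕ) → n ≡ 5 * a → v₂ a ≤⁺ [ 5 ] → v₂ (B[4,1] n) ≡ [ 1 ] +∞ v₂ a)
    × (n % 5 ≡ 1 → v₂ (B[4,1] n) ≡ [ 0 ])
    × (∀ (a : ℕ) → n ≡ 5 * a + 2 → v₂ a ≤⁺ [ 4 ] → v₂ (B[4,1] n) ≡ [ 1 ] +∞ v₂ a)
    × (∀ (a : ℕ) → n ≡ 5 * a + 3 → v₂ (a * (a + 1)) ≤⁺ [ 5 ] → v₂ (B[4,1] n) ≡ [ 1 ] +∞ v₂ (a * (a + 1)))
    × (n % 5 ≡ 4 → v₂ (B[4,1] n) ≡ [ 0 ])
theorem14 n =
    -- The index is rewritten as `5 * a + 0` to fit `v₂-B`. Here and below, `toWitness` makes the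
    -- type checker evaluate all 64 cases.
    (λ { a refl v≤5 → trans (cong (λ # → v₂ (B[4,1] #)) (sym (+-identityʳ (5 * a))))
                            (v₂-B 1 5 0 id id-% (toWitness {a? = valuations? 1 5 0 id} _) a v≤5) })
  , v₂-B-odd 1 (toWitness {a? = valuations? 0 0 1 (const 1)} _) n
  , (λ { a refl → v₂-B 1 4 2 id id-% (toWitness {a? = valuations? 1 4 2 id} _) a })
  , (λ { a refl → v₂-B 1 5 3 a[a+1] a[a+1]-% (toWitness {a? = valuations? 1 5 3 a[a+1]} _) a })
  , v₂-B-odd 4 (toWitness {a? = valuations? 0 0 4 (const 1)} _) n
  where
  id-% : ∀ a → a % 2 ^ 6 % 2 ^ 6 ≡ a % 2 ^ 6
  id-% a = m%n%n≡m%n a (2 ^ 6)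
  a[a+1] : ℕ → ℕ
  a[a+1] a = a * (a + 1)
  a[a+1]-% : ∀ a → a[a+1] (a % 2 ^ 6) % 2 ^ 6 ≡ a[a+1] a % 2 ^ 6
  a[a+1]-% a = *-resp-% r a (r + 1) (a + 1) (2 ^ 6) (id-% a) (+-resp-% r a 1 1 (2 ^ 6) (id-% a) refl)
    where
    r : ℕ
    r = a % 2 ^ 6
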